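{- The hypergraph partition functions $Z_{\mathrm{RC}}$, $Z_{\mathrm{P}}$ and $Z_{\mathrm{Grimmett}}$ do not specialize to each other, even up to multiplication by a factor depending only on global parameters. That is, for any two distinct $F_1,F_2\in\{Z_{\mathrm{RC}},Z_{\mathrm{P}},Z_{\mathrm{Grimmett}}\}$, there do not exist a field $K\supseteq\mathbb{C}(q,w)$, elements $s,t\in K$ and a function $c$ with values in $K$ such that for all hypergraphs $H$ $$F_2(H;q,w)=c\big(v(H),\kappa(H),|E(H)|,d(E(H))\big)\cdot F_1(H;s,t).$$
   Context: A hypergraph is a pair $H=(V,E)$ where $V$ is a finite set and $E=E(H)$ is a finite multiset (parallel hyperedges are allowed and treated as distinct elements of $E$) of multisets of elements of $V$, called hyperedges. For $e\in E$, $d(e)$ is the size of $e$ counted with multiplicity; it is always assumed that $d(e)>1$. Write $v(H)=|V|$. $\kappa(H)$ is the number of connected components of the bipartite incidence graph with vertex classes $V$ and $E$, in which $u\in V$ and $e\in E$ are joined by as many edges as the multiplicity of $u$ in $e$. For $A\subseteq E$ let $\kappa(A)=\kappa((V,A))$, $d(A)=\sum_{e\in A}d(e)$, and $|A|$ is the number of hyperedges in $A$. The global parameters of $H$ are the number of vertices $v(H)$, of components $\kappa(H)$, of edges $|E(H)|$, and the total degree $d(E(H))$. The partition functions, as polynomials in two variables, are $Z_{\mathrm{RC}}(H;q,v)=\sum_{A\subseteq E}q^{\kappa(A)}\prod_{e\in A}v^{d(e)-1}$, $Z_{\mathrm{P}}(H;q,w)=\sum_{A\subseteq E}q^{\kappa(A)}\prod_{e\in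 A}(w^{d(e)-1}-1)$, $Z_{\mathrm{Grimmett}}(H;q,w)=\sum_{A\subseteq E}q^{\kappa(A)}(w-1)^{|A|}$. ($q,w$ are indeterminates; the second variable of $Z_{\mathrm{RC}}$ may be renamed $w$.) One invariant specializes to another if the latter is obtained from the former by a fixed substitution for its variables. -}

module Defs where

open import Algebra.Apartness.Bundles using (HeytingField; HeytingCommutativeRing)
open import Algebra.Bundles using (CommutativeRing)
open import Algebra.Bundles.Raw using (RawRing)
open import Algebra.Definitions.RawSemiring using () renaming (_^_ to pow)
open import Algebra.Morphism.Structures using (IsRingMonomorphism)
open import Data.Fin.Base using (Fin; _↑ˡ_; _↑ʳ_)
open import Data.Fin.Properties using () renaming (_≟_ to _≟ᶠ_)
open import Data.List.Base as List
  using (List; []; _∷_; _++_; length; map; foldr; concatMap; replicate; allFin; deduplicate)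
open import Data.List.Membership.Propositional using (_∈_)
open import Data.List.Relation.Unary.Any using (here; there)
open import Data.Nat.Base as ℕ using (ℕ; zero; suc; _⊔_)
open import Data.Nat.ListAction using (sum)
open import Data.Nat.Properties as ℕₚ using ()
open import Data.Product.Base using (Σ; ∃; ∃-syntax; _×_; _,_; proj₁; proj₂; map₂)
open import Data.Rational.Base as ℚ using (ℚ; 0ℚ; 1ℚ; ½; ∣_∣)
open import Data.Rational.Properties as ℚₚ using ()
open import Data.Rational.Solver using (module +-*-Solver)
open import Data.Sum.Base using (_⊎_; inj₁; inj₂)
open import Data.Vec.Base as Vec using (Vec)
open import Level using (Level; 0ℓ) renaming (suc to lsuc; _⊔_ to _⊔ˡ_)
open import Relation.Binary.Construct.Closure.Equivalence as EqC using (EqClosure)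
open import Relation.Binary.Construct.Closure.ReflexiveTransitive as Star using (_◅_)
open import Relation.Binary.Construct.Closure.Symmetric using (fwd; bwd)
open import Relation.Binary.PropositionalEquality using (_≡_; refl; sym; cong; cong₂; subst)
open import Relation.Nullary using (¬_; Dec)
open import Relation.Nullary.Decidable using (map′; _×-dec_; _⊎-dec_)

IsCauchy : (ℕ → ℚ) → Set
IsCauchy x = ∀ ε → 0ℚ ℚ.< ε →
  ∃[ N ] (∀ m n → N ℕ.≤ m → N ℕ.≤ n → ∣ x m ℚ.- x n ∣ ℚ.≤ ε)

private

  half-pos : ∀ {ε} → 0ℚ ℚ.< ε → 0ℚ ℚ.< ½ ℚ.* ε
  half-pos {ε} 0<ε = subst (ℚ._< ½ ℚ.* ε) (ℚₚ.*-zeroʳ ½) (ℚₚ.*-monoʳ-<-pos ½ 0<ε)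

  halves : ∀ ε → ½ ℚ.* ε ℚ.+ ½ ℚ.* ε ≡ ε
  halves ε = begin-equality
    ½ ℚ.* ε ℚ.+ ½ ℚ.* ε  ≡⟨ ℚₚ.*-distribʳ-+ ε ½ ½ ⟨
    1ℚ ℚ.* ε             ≡⟨ ℚₚ.*-identityˡ ε ⟩
    ε                    ∎
    where open ℚₚ.≤-Reasoning

  const-cauchy : ∀ a → IsCauchy (λ _ → a)
  const-cauchy a ε 0<ε = 0 , λ _ _ _ _ → begin
    ∣ a ℚ.- a ∣  ≡⟨ cong ∣_∣ (ℚₚ.+-inverseʳ a) ⟩
    0ℚ           ≤⟨ ℚₚ.<⇒≤ 0<ε ⟩
    ε            ∎
    where open ℚₚ.≤-Reasoning

  neg-cauchy : ∀ {x} → IsCauchy x → IsCauchy (λ n → ℚ.- x n)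
  neg-cauchy {x} cx ε 0<ε with cx ε 0<ε
  ... | N , hx = N , λ m n N≤m N≤n → begin
    ∣ ℚ.- x m ℚ.- ℚ.- x n ∣  ≡⟨ cong ∣_∣ (ℚₚ.neg-distrib-+ (x m) (ℚ.- x n)) ⟨
    ∣ ℚ.- (x m ℚ.- x n) ∣    ≡⟨ ℚₚ.∣-p∣≡∣p∣ (x m ℚ.- x n) ⟩
    ∣ x m ℚ.- x n ∣          ≤⟨ hx m n N≤m N≤n ⟩
    ε                        ∎
    where open ℚₚ.≤-Reasoning

  +-cauchy : ∀ {x y} → IsCauchy x → IsCauchy y → IsCauchy (λ n → x n ℚ.+ y n)
  +-cauchy {x} {y} cx cy ε 0<ε
    with cx (½ ℚ.* ε) (half-pos 0<ε) | cy (½ ℚ.* ε) (half-pos 0<ε)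
  ... | M , hx | N , hy = M ⊔ N , λ m n p q → begin
    ∣ (x m ℚ.+ y m) ℚ.- (x n ℚ.+ y n) ∣
      ≡⟨ cong ∣_∣ (rearrange (x m) (y m) (x n) (y n)) ⟩
    ∣ (x m ℚ.- x n) ℚ.+ (y m ℚ.- y n) ∣
      ≤⟨ ℚₚ.∣p+q∣≤∣p∣+∣q∣ (x m ℚ.- x n) (y m ℚ.- y n) ⟩
    ∣ x m ℚ.- x n ∣ ℚ.+ ∣ y m ℚ.- y n ∣
      ≤⟨ ℚₚ.+-mono-≤ (hx m n (ℕₚ.m⊔n≤o⇒m≤o M N p) (ℕₚ.m⊔n≤o⇒m≤o M N q))
                     (hy m n (ℕₚ.m⊔n≤o⇒n≤o M N p) (ℕₚ.m⊔n≤o⇒n≤o M N q)) ⟩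
    ½ ℚ.* ε ℚ.+ ½ ℚ.* ε
      ≡⟨ halves ε ⟩
    ε ∎
    where
    open ℚₚ.≤-Reasoning
    rearrange : ∀ a b c d → (a ℚ.+ b) ℚ.- (c ℚ.+ d) ≡ (a ℚ.- c) ℚ.+ (b ℚ.- d)
    rearrange = solve 4 (λ a b c d → (a :+ b) :- (c :+ d) := (a :- c) :+ (b :- d)) refl
      where open +-*-Solver

  eventually-bounded : ∀ {x} → IsCauchy x →
    ∃[ b ] 0ℚ ℚ.≤ b × ∃[ N ] (∀ n → N ℕ.≤ n → ∣ x n ∣ ℚ.≤ b)
  eventually-bounded {x} cx with cx 1ℚ (ℚₚ.positive⁻¹ 1ℚ)
  ... | N , hx = 1ℚ ℚ.+ ∣ x N ∣
    , ℚₚ.+-mono-≤ (ℚₚ.<⇒≤ (ℚₚ.positive⁻¹ 1ℚ)) (ℚₚ.0≤∣p∣ (x N))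
    , N , λ n N≤n → begin
    ∣ x n ∣                    ≡⟨ cong ∣_∣ (split (x n) (x N)) ⟩
    ∣ (x n ℚ.- x N) ℚ.+ x N ∣  ≤⟨ ℚₚ.∣p+q∣≤∣p∣+∣q∣ (x n ℚ.- x N) (x N) ⟩
    ∣ x n ℚ.- x N ∣ ℚ.+ ∣ x N ∣
      ≤⟨ ℚₚ.+-monoˡ-≤ ∣ x N ∣ (hx n N N≤n ℕₚ.≤-refl) ⟩
    1ℚ ℚ.+ ∣ x N ∣             ∎
    where
    open ℚₚ.≤-Reasoning
    split : ∀ a b → a ≡ (a ℚ.- b) ℚ.+ b
    split = solve 2 (λ a b → a := (a :- b) :+ b) refl
      where open +-*-Solver

  *-mono-≤-∣∣ : ∀ p q {b d} → 0ℚ ℚ.≤ b → ∣ p ∣ ℚ.≤ b → ∣ q ∣ ℚ.≤ d → ∣ p ℚ.* q ∣ ℚ.≤ b ℚ.* d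
  *-mono-≤-∣∣ p q {b} {d} 0≤b p≤b q≤d = begin
    ∣ p ℚ.* q ∣      ≡⟨ ℚₚ.∣p*q∣≡∣p∣*∣q∣ p q ⟩
    ∣ p ∣ ℚ.* ∣ q ∣  ≤⟨ ℚₚ.*-monoʳ-≤-nonNeg ∣ q ∣ {{ℚₚ.∣-∣-nonNeg q}} p≤b ⟩
    b ℚ.* ∣ q ∣      ≤⟨ ℚₚ.*-monoˡ-≤-nonNeg b {{ℚ.nonNegative 0≤b}} q≤d ⟩
    b ℚ.* d          ∎
    where open ℚₚ.≤-Reasoning

  majorant : ∀ {b c} → 0ℚ ℚ.≤ b → 0ℚ ℚ.≤ c → ∃[ B ] 0ℚ ℚ.< B × b ℚ.≤ B × c ℚ.≤ B
  majorant {b} {c} 0≤b 0≤c = 1ℚ ℚ.+ (b ℚ.+ c)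
    , ℚₚ.+-mono-<-≤ (ℚₚ.positive⁻¹ 1ℚ) (ℚₚ.+-mono-≤ 0≤b 0≤c)
    , ℚₚ.≤-trans (subst (ℚ._≤ b ℚ.+ c) (ℚₚ.+-identityʳ b) (ℚₚ.+-monoʳ-≤ b 0≤c)) b+c≤B
    , ℚₚ.≤-trans (subst (ℚ._≤ b ℚ.+ c) (ℚₚ.+-identityˡ c) (ℚₚ.+-monoˡ-≤ c 0≤b)) b+c≤B
    where
    b+c≤B : b ℚ.+ c ℚ.≤ 1ℚ ℚ.+ (b ℚ.+ c)
    b+c≤B = subst (ℚ._≤ 1ℚ ℚ.+ (b ℚ.+ c)) (ℚₚ.+-identityˡ (b ℚ.+ c))
      (ℚₚ.+-monoˡ-≤ (b ℚ.+ c) (ℚₚ.<⇒≤ (ℚₚ.positive⁻¹ 1ℚ)))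

  divide : ∀ {B η} → 0ℚ ℚ.< B → 0ℚ ℚ.< η → ∃[ δ ] 0ℚ ℚ.< δ × B ℚ.* δ ≡ η
  divide {B} {η} 0<B 0<η = B⁻¹ ℚ.* η
    , subst (ℚ._< B⁻¹ ℚ.* η) (ℚₚ.*-zeroʳ B⁻¹) (ℚₚ.*-monoʳ-<-pos B⁻¹ {{ℚₚ.1/pos⇒pos B {{B>0}}}} 0<η)
    , (begin-equality
      B ℚ.* (B⁻¹ ℚ.* η)  ≡⟨ ℚₚ.*-assoc B B⁻¹ η ⟨
      (B ℚ.* B⁻¹) ℚ.* η  ≡⟨ cong (ℚ._* η) (ℚₚ.*-inverseʳ B {{B≢0}}) ⟩
      1ℚ ℚ.* η           ≡⟨ ℚₚ.*-identityˡ η ⟩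
      η                  ∎)
    where
    open ℚₚ.≤-Reasoning
    B>0 : ℚ.Positive B
    B>0 = ℚ.positive 0<B
    B≢0 : ℚ.NonZero B
    B≢0 = ℚₚ.pos⇒nonZero B {{B>0}}
    B⁻¹ : ℚ
    B⁻¹ = (ℚ.1/ B) {{B≢0}}

  *-cauchy : ∀ {x y} → IsCauchy x → IsCauchy y → IsCauchy (λ n → x n ℚ.* y n)
  *-cauchy {x} {y} cx cy ε 0<ε
    = let b , 0≤b , N₁ , hb = eventually-bounded {x} cx
          c , 0≤c , N₂ , hc   = eventually-bounded {y} cy
          B , 0<B , b≤B , c≤B = majorant 0≤b 0≤c
          δ , 0<δ , Bδ≡½ε     = divide 0<B (half-pos 0<ε)
          N₃ , hx             = cx δ 0<δ
          N₄ , hy             = cy δ 0<δ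
      in (N₁ ⊔ N₂) ⊔ (N₃ ⊔ N₄) ,
         bound 0<B Bδ≡½ε
           (λ n p → ℚₚ.≤-trans (hb n p) b≤B) (λ n p → ℚₚ.≤-trans (hc n p) c≤B) hx hy
    where
    open ℚₚ.≤-Reasoning

    rearrange : ∀ p q r s →
      p ℚ.* q ℚ.- r ℚ.* s ≡ p ℚ.* (q ℚ.- s) ℚ.+ s ℚ.* (p ℚ.- r)
    rearrange = solve 4
      (λ p q r s → p :* q :- r :* s := p :* (q :- s) :+ s :* (p :- r)) refl
      where open +-*-Solver

    bound : ∀ {B δ N₁ N₂ N₃ N₄} → 0ℚ ℚ.< B → B ℚ.* δ ≡ ½ ℚ.* ε →
            (∀ n → N₁ ℕ.≤ n → ∣ x n ∣ ℚ.≤ B) →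
            (∀ n → N₂ ℕ.≤ n → ∣ y n ∣ ℚ.≤ B) →
            (∀ m n → N₃ ℕ.≤ m → N₃ ℕ.≤ n → ∣ x m ℚ.- x n ∣ ℚ.≤ δ) →
            (∀ m n → N₄ ℕ.≤ m → N₄ ℕ.≤ n → ∣ y m ℚ.- y n ∣ ℚ.≤ δ) →
            ∀ m n → (N₁ ⊔ N₂) ⊔ (N₃ ⊔ N₄) ℕ.≤ m → (N₁ ⊔ N₂) ⊔ (N₃ ⊔ N₄) ℕ.≤ n →
            ∣ x m ℚ.* y m ℚ.- x n ℚ.* y n ∣ ℚ.≤ ε
    bound {B} {δ} {N₁} {N₂} {N₃} {N₄} 0<B Bδ≡½ε hb hc hx hy m n p q = begin
      ∣ x m ℚ.* y m ℚ.- x n ℚ.* y n ∣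
        ≡⟨ cong ∣_∣ (rearrange (x m) (y m) (x n) (y n)) ⟩
      ∣ x m ℚ.* (y m ℚ.- y n) ℚ.+ y n ℚ.* (x m ℚ.- x n) ∣
        ≤⟨ ℚₚ.∣p+q∣≤∣p∣+∣q∣ (x m ℚ.* (y m ℚ.- y n)) (y n ℚ.* (x m ℚ.- x n)) ⟩
      ∣ x m ℚ.* (y m ℚ.- y n) ∣ ℚ.+ ∣ y n ℚ.* (x m ℚ.- x n) ∣
        ≤⟨ ℚₚ.+-mono-≤
             (*-mono-≤-∣∣ (x m) (y m ℚ.- y n) (ℚₚ.<⇒≤ 0<B)
               (hb m (ℕₚ.m⊔n≤o⇒m≤o N₁ N₂ p₁₂))
               (hy m n (ℕₚ.m⊔n≤o⇒n≤o N₃ N₄ p₃₄) (ℕₚ.m⊔n≤o⇒n≤o N₃ N₄ q₃₄)))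
             (*-mono-≤-∣∣ (y n) (x m ℚ.- x n) (ℚₚ.<⇒≤ 0<B)
               (hc n (ℕₚ.m⊔n≤o⇒n≤o N₁ N₂ q₁₂))
               (hx m n (ℕₚ.m⊔n≤o⇒m≤o N₃ N₄ p₃₄) (ℕₚ.m⊔n≤o⇒m≤o N₃ N₄ q₃₄))) ⟩
      B ℚ.* δ ℚ.+ B ℚ.* δ
        ≡⟨ cong₂ ℚ._+_ Bδ≡½ε Bδ≡½ε ⟩
      ½ ℚ.* ε ℚ.+ ½ ℚ.* ε
        ≡⟨ halves ε ⟩
      ε ∎
      where
      p₁₂ = ℕₚ.m⊔n≤o⇒m≤o (N₁ ⊔ N₂) (N₃ ⊔ N₄) p
      q₁₂ = ℕₚ.m⊔n≤o⇒m≤o (N₁ ⊔ N₂) (N₃ ⊔ N₄) q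
      p₃₄ = ℕₚ.m⊔n≤o⇒n≤o (N₁ ⊔ N₂) (N₃ ⊔ N₄) p
      q₃₄ = ℕₚ.m⊔n≤o⇒n≤o (N₁ ⊔ N₂) (N₃ ⊔ N₄) q

record Real : Set where
  constructor mkReal
  field
    seq    : ℕ → ℚ
    cauchy : IsCauchy seq

open Real public

ℝ : RawRing 0ℓ 0ℓ
ℝ = record
  { Carrier = Real
  ; _≈_ = λ x y → ∀ ε → 0ℚ ℚ.< ε → ∃[ N ] (∀ n → N ℕ.≤ n → ∣ seq x n ℚ.- seq y n ∣ ℚ.≤ ε)
  ; _+_ = λ x y → mkReal (λ n → seq x n ℚ.+ seq y n) (+-cauchy {seq x} {seq y} (cauchy x) (cauchy y))
  ; _*_ = λ x y → mkReal (λ n → seq x n ℚ.* seq y n) (*-cauchy {seq x} {seq y} (cauchy x) (cauchy y))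
  ; -_  = λ x → mkReal (λ n → ℚ.- seq x n) (neg-cauchy {seq x} (cauchy x))
  ; 0#  = mkReal (λ _ → 0ℚ) (const-cauchy 0ℚ)
  ; 1#  = mkReal (λ _ → 1ℚ) (const-cauchy 1ℚ)
  }

-- (a , b) stands for a + b i.
ℂ : RawRing 0ℓ 0ℓ
ℂ = record
  { Carrier = R.Carrier × R.Carrier
  ; _≈_ = λ (a , b) (c , d) → a R.≈ c × b R.≈ d
  ; _+_ = λ (a , b) (c , d) → a R.+ c , b R.+ d
  ; _*_ = λ (a , b) (c , d) → (a R.* c) R.+ (R.- (b R.* d)) , (a R.* d) R.+ (b R.* c)
  ; -_  = λ (a , b) → R.- a , R.- b
  ; 0#  = R.0# , R.0#
  ; 1#  = R.1# , R.0#
  }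
  where module R = RawRing ℝ

module _ {c ℓ} (R : RawRing c ℓ) where
  open RawRing R

  coeff : List Carrier → ℕ → Carrier
  coeff []      _       = 0#
  coeff (a ∷ _) zero    = a
  coeff (_ ∷ p) (suc n) = coeff p n

  private
    infixl 6 _⊞_
    infixl 7 _⊠_

    _⊞_ : List Carrier → List Carrier → List Carrier
    []      ⊞ q       = q
    p       ⊞ []      = p
    (a ∷ p) ⊞ (b ∷ q) = (a + b) ∷ (p ⊞ q)

    _⊠_ : List Carrier → List Carrier → List Carrier
    []      ⊠ q = []
    (a ∷ p) ⊠ q = map (a *_) q ⊞ (0# ∷ (p ⊠ q))

  -- Coefficients are listed from the constant term upwards; equality ignores
  -- trailing zeros.
  Poly : RawRing c ℓ
  Poly = record
    { Carrier = List Carrier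
    ; _≈_ = λ p q → ∀ n → coeff p n ≈ coeff q n
    ; _+_ = _⊞_
    ; _*_ = _⊠_
    ; -_  = map (-_)
    ; 0#  = []
    ; 1#  = 1# ∷ []
    }

-- ℂ[q,w] as (ℂ[q])[w]
ℂ[q,w] : RawRing 0ℓ 0ℓ
ℂ[q,w] = Poly (Poly ℂ)

qᵖ wᵖ : RawRing.Carrier ℂ[q,w]
qᵖ = (0# ∷ 1# ∷ []) ∷ []
  where open RawRing ℂ
wᵖ = 0# ∷ 1# ∷ []
  where open RawRing (Poly ℂ)

-- HeytingField is the library's notion of field.  Since x # y holds iff x - y is
-- invertible, # carries no extra structure, and classically it is ≉.
module Field {c ℓ₁ ℓ₂} (K : HeytingField c ℓ₁ ℓ₂) where
  rawRing : RawRing c ℓ₁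
  rawRing = CommutativeRing.rawRing
    (HeytingCommutativeRing.commutativeRing (HeytingField.heytingCommutativeRing K))

-- The field of fractions of ℂ[q,w], given by its defining properties: a field
-- with an embedding of ℂ[q,w] in which every element is a quotient P / Q.
record RationalFunctionField c ℓ₁ ℓ₂ : Set (lsuc (c ⊔ˡ ℓ₁ ⊔ˡ ℓ₂)) where
  field
    𝔽 : HeytingField c ℓ₁ ℓ₂
  open HeytingField 𝔽 public
  private module P = RawRing ℂ[q,w]
  field
    polynomial   : P.Carrier → Carrier
    monomorphism : IsRingMonomorphism ℂ[q,w] (Field.rawRing 𝔽) polynomial
    fraction     : ∀ x → ∃[ P ] ∃[ Q ] ¬ (Q P.≈ P.0#) × (x * polynomial Q ≈ polynomial P)

  q w : Carrier
  q = polynomial qᵖ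
  w = polynomial wᵖ

-- A field 𝕂 ⊇ F, the inclusion being ι.
record Extension {a b d} (F : HeytingField a b d) c ℓ₁ ℓ₂
       : Set (a ⊔ˡ b ⊔ˡ lsuc (c ⊔ˡ ℓ₁ ⊔ˡ ℓ₂)) where
  field
    𝕂            : HeytingField c ℓ₁ ℓ₂
  open HeytingField 𝕂 public
  field
    ι            : HeytingField.Carrier F → Carrier
    monomorphism : IsRingMonomorphism (Field.rawRing F) (Field.rawRing 𝕂) ι

record Multigraph : Set where
  constructor multigraph
  field
    order : ℕ
    edges : List (Fin order × Fin order)

Connected : ∀ {n} → List (Fin n × Fin n) → Fin n → Fin n → Set
Connected es = EqClosure (λ x y → (x , y) ∈ es)

private
  module _ {n} {a b : Fin n} {es : List (Fin n × Fin n)} where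

    Through : Fin n → Fin n → Set
    Through x y = Connected es x y
      ⊎ (Connected es x a × Connected es b y)
      ⊎ (Connected es x b × Connected es a y)

    weaken : ∀ {x y} → Connected es x y → Connected ((a , b) ∷ es) x y
    weaken = EqC.gmap (λ x → x) there

    to : ∀ {x y} → Through x y → Connected ((a , b) ∷ es) x y
    to (inj₁ p)              = weaken p
    to (inj₂ (inj₁ (p , r))) =
      EqC.transitive _ (weaken p) (fwd (here refl) ◅ weaken r)
    to (inj₂ (inj₂ (p , r))) =
      EqC.transitive _ (weaken p) (bwd (here refl) ◅ weaken r)

    extend : ∀ {x y z} → Connected es x y → Through y z → Through x z
    extend s (inj₁ p)              = inj₁ (EqC.transitive _ s p)
    extend s (inj₂ (inj₁ (p , r))) = inj₂ (inj₁ (EqC.transitive _ s p , r))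
    extend s (inj₂ (inj₂ (p , r))) = inj₂ (inj₂ (EqC.transitive _ s p , r))

    cross : ∀ {z} → Through b z → Through a z
    cross (inj₁ p)              = inj₂ (inj₁ (Star.ε , p))
    cross (inj₂ (inj₁ (_ , r))) = inj₂ (inj₁ (Star.ε , r))
    cross (inj₂ (inj₂ (_ , r))) = inj₁ r

    cross⁻¹ : ∀ {z} → Through a z → Through b z
    cross⁻¹ (inj₁ p)              = inj₂ (inj₂ (Star.ε , p))
    cross⁻¹ (inj₂ (inj₁ (_ , r))) = inj₁ r
    cross⁻¹ (inj₂ (inj₂ (_ , r))) = inj₂ (inj₂ (Star.ε , r))

    from : ∀ {x y} → Connected ((a , b) ∷ es) x y → Through x y
    from Star.ε                        = inj₁ Star.ε
    from (fwd (here refl) ◅ p)    = cross (from p)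
    from (bwd (here refl) ◅ p)    = cross⁻¹ (from p)
    from (fwd (there x∈es) ◅ p)   = extend (fwd x∈es ◅ Star.ε) (from p)
    from (bwd (there x∈es) ◅ p)   = extend (bwd x∈es ◅ Star.ε) (from p)

connected? : ∀ {n} (es : List (Fin n × Fin n)) (x y : Fin n) → Dec (Connected es x y)
connected? []             x y =
  map′ (λ { refl → Star.ε })
       (λ { Star.ε → refl ; (fwd () ◅ _) ; (bwd () ◅ _) })
       (x ≟ᶠ y)
connected? ((a , b) ∷ es) x y = map′ to from
  (connected? es x y ⊎-dec
  ((connected? es x a ×-dec connected? es b y) ⊎-dec
   (connected? es x b ×-dec connected? es a y)))

-- deduplicate keeps exactly one node from each connected component.
#components : Multigraph → ℕ
#components (multigraph n es) = length (deduplicate (connected? es) (allFin n))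

-- A multiset of vertices is given by its multiplicities.
record Hyperedge (n : ℕ) : Set where
  field
    multiplicity : Vec ℕ n

  d : ℕ
  d = Vec.sum multiplicity

  field
    d>1 : 1 ℕ.< d

open Hyperedge public

-- The vertex set is Fin order.  Positions in the list distinguish parallel
-- hyperedges.
record Hypergraph : Set where
  constructor hypergraph
  field
    order      : ℕ
    hyperedges : List (Hyperedge order)

open Hypergraph public

totalDegree : ∀ {n} → List (Hyperedge n) → ℕ
totalDegree A = sum (map d A)

-- Nodes: first the vertices, then the hyperedges.
incidenceGraph : Hypergraph → Multigraph
incidenceGraph (hypergraph n E) = multigraph (n ℕ.+ length E)
  (concatMap (λ u → concatMap (λ i →
     replicate (Vec.lookup (multiplicity (List.lookup E i)) u) (u ↑ˡ length E , n ↑ʳ i))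
   (allFin (length E))) (allFin n))

κ : Hypergraph → ℕ
κ H = #components (incidenceGraph H)

-- One entry for each set of positions, so a list of length m has 2ᵐ of them.
subsets : ∀ {a} {X : Set a} → List X → List (List X)
subsets []       = [] ∷ []
subsets (x ∷ xs) = subsets xs ++ map (x ∷_) (subsets xs)

data PartitionFunction : Set where
  RC P Grimmett : PartitionFunction

module _ {c ℓ} (R : RawRing c ℓ) where
  open RawRing R

  private
    infixr 8 _^_
    _^_ : Carrier → ℕ → Carrier
    _^_ = pow rawSemiring

    ∑ ∏ : {X : Set} → List X → (X → Carrier) → Carrier
    ∑ xs f = foldr (λ x s → f x + s) 0# xs
    ∏ xs f = foldr (λ x s → f x * s) 1# xs

  weight : ∀ {n} → PartitionFunction → Carrier → List (Hyperedge n) → Carrier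
  weight RC       y A = ∏ A λ e → y ^ (d e ℕ.∸ 1)
  weight P        y A = ∏ A λ e → (y ^ (d e ℕ.∸ 1)) + (- 1#)
  weight Grimmett y A = (y + (- 1#)) ^ length A

  -- The value of the partition function polynomial at the point (x , y) of R.
  Z : PartitionFunction → Hypergraph → Carrier → Carrier → Carrier
  Z F H x y = ∑ (subsets (hyperedges H)) λ A →
    (x ^ κ (hypergraph (order H) A)) * weight F y A

{-# OPTIONS --safe #-}
module Submission where

open import Defs
open import Algebra.Apartness.Bundles using (HeytingField; HeytingCommutativeRing)
open import Algebra.Bundles using (CommutativeRing)
open import Algebra.Bundles.Raw using (RawRing)
open import Algebra.Morphism.Construct.Composition using (isRingMonomorphism)
open import Algebra.Morphism.Structures using (IsRingMonomorphism)
import Algebra.Properties.AbelianGroup as AbelianGroupProperties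
import Algebra.Properties.Ring as RingProperties
import Algebra.Properties.Semiring.Mult.TCOptimised as Multiples
import Algebra.Solver.Ring as RingSolver
open import Algebra.Solver.Ring.AlmostCommutativeRing
  using (fromCommutativeRing; _-Raw-AlmostCommutative⟶_)
open import Data.Integer.Base as ℤ using (ℤ; +_; -[1+_]; _⊖_)
open import Data.Integer.Properties as ℤₚ using ()
open import Data.List.Base using ([]; _∷_; length)
open import Data.Maybe.Base using (just; nothing)
open import Data.Nat.Base as ℕ using (ℕ; zero; suc)
open import Data.Nat.Properties as ℕₚ using ()
open import Data.Product.Base using (_×_; _,_; proj₁; proj₂; Σ-syntax)
open import Data.Rational.Base as ℚ using (0ℚ; 1ℚ; ½)
open import Data.Rational.Properties as ℚₚ using ()
open import Data.Vec.Base as Vec using (Vec; []; _∷_)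
open import Relation.Binary.Definitions using (WeaklyDecidable)
open import Relation.Binary.PropositionalEquality as ≡ using (_≡_; _≢_)
open import Relation.Nullary using (¬_; yes; no; contradiction)
open import Relation.Nullary.Decidable using (True; toWitness; from-no)

-- If F₂ = c · F₁ with c depending only on the global parameters, then any linear
-- combination Δ of hypergraphs with equal parameters satisfies Δ F₂ = c · Δ F₁.
-- Three combinations suffice (their values at (x , y)):
--            RC                        P                         Grimmett
--   Δ₁   x y (y - 1)²              0                         0
--   Δ₂   x y (x - 1) (y - 1)       x y (x - 1) (y - 1)       0
--   Δ₃   x y (x - 1) (y - 1)       x (x - 1) (y - 1) (y - 2) as for P
-- When F₁ vanishes on some Δᵢ where F₂ does not, this is a contradiction at once.
-- Otherwise F₂ vanishes on some Δᵢ, and since c ≠ 0 there a factor of Δᵢ F₁ (s , t)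
-- vanishes; that factor also kills Δⱼ F₁ (s , t) for some j with Δⱼ F₂ ≠ 0.

-- A ring solver with integer coefficients over any commutative ring.

module IntegerCoefficients {c ℓ} (R : CommutativeRing c ℓ) where
  open CommutativeRing R
  open Multiples semiring using (×-homo-+; ×1-homo-*; 1+×) renaming (_×_ to _·_)
  open RingProperties ring using (-0#≈0#; -‿distribˡ-*; -‿distribʳ-*; -‿involutive)
  open AbelianGroupProperties +-abelianGroup using (⁻¹-∙-comm)
  open import Relation.Binary.Reasoning.Setoid setoid

  -- Equality is decidable in `ℤ` but perhaps not in `R`, so polynomials are normalised over `ℤ` and
  -- mapped to `R` along this homomorphism.
  fromℤ : ℤ → Carrier
  fromℤ (+ n)    = n · 1#
  fromℤ -[1+ n ] = - (suc n · 1#)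

  fromℤ-⊖ : ∀ m n → fromℤ (m ⊖ n) ≈ m · 1# - n · 1#
  fromℤ-⊖ zero    zero    = sym (-‿inverseʳ 0#)
  fromℤ-⊖ zero    (suc n) = sym (+-identityˡ _)
  fromℤ-⊖ (suc m) zero    = sym (trans (+-congˡ -0#≈0#) (+-identityʳ _))
  fromℤ-⊖ (suc m) (suc n) = begin
    fromℤ (suc m ⊖ suc n)                ≡⟨ ≡.cong fromℤ (ℤₚ.[1+m]⊖[1+n]≡m⊖n m n) ⟩
    fromℤ (m ⊖ n)                        ≈⟨ fromℤ-⊖ m n ⟩
    -- Inserting `1# - 1#` lets each of the two multiples absorb one unit.
    m · 1# - n · 1#                      ≈⟨ +-congʳ (+-identityˡ _) ⟨
    0# + m · 1# - n · 1#                 ≈⟨ +-congʳ (+-congʳ (-‿inverseʳ 1#)) ⟨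
    1# - 1# + m · 1# - n · 1#            ≈⟨ +-congʳ (+-assoc _ _ _) ⟩
    1# + (- 1# + m · 1#) - n · 1#        ≈⟨ +-congʳ (+-congˡ (+-comm _ _)) ⟩
    1# + (m · 1# - 1#) - n · 1#          ≈⟨ +-congʳ (+-assoc _ _ _) ⟨
    1# + m · 1# - 1# - n · 1#            ≈⟨ +-assoc _ _ _ ⟩
    1# + m · 1# + (- 1# - n · 1#)        ≈⟨ +-cong (sym (1+× m 1#)) (⁻¹-∙-comm _ _) ⟩
    suc m · 1# - (1# + n · 1#)           ≈⟨ +-congˡ (-‿cong (1+× n 1#)) ⟨
    suc m · 1# - suc n · 1#              ∎

  fromℤ-neg : ∀ i → fromℤ (ℤ.- i) ≈ - fromℤ i
  fromℤ-neg (+ zero)  = sym -0#≈0#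
  fromℤ-neg (+ suc n) = refl
  fromℤ-neg -[1+ n ]  = sym (-‿involutive _)

  fromℤ-+ : ∀ i j → fromℤ (i ℤ.+ j) ≈ fromℤ i + fromℤ j
  fromℤ-+ (+ m)    (+ n)    = ×-homo-+ 1# m n
  fromℤ-+ (+ m)    -[1+ n ] = fromℤ-⊖ m (suc n)
  fromℤ-+ -[1+ m ] (+ n)    = trans (fromℤ-⊖ n (suc m)) (+-comm _ _)
  fromℤ-+ -[1+ m ] -[1+ n ] = begin
    - (suc (suc (m ℕ.+ n)) · 1#)     ≡⟨ ≡.cong (λ k → - (suc k · 1#)) (ℕₚ.+-suc m n) ⟨
    - ((suc m ℕ.+ suc n) · 1#)       ≈⟨ -‿cong (×-homo-+ 1# (suc m) (suc n)) ⟩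
    - (suc m · 1# + suc n · 1#)      ≈⟨ ⁻¹-∙-comm _ _ ⟨
    - (suc m · 1#) - suc n · 1#      ∎

  fromℤ-pos-* : ∀ m n → fromℤ (+ m ℤ.* + n) ≈ m · 1# * n · 1#
  fromℤ-pos-* m n = trans (reflexive (≡.cong fromℤ (≡.sym (ℤₚ.pos-* m n)))) (×1-homo-* m n)

  -- Strips a sign from the left factor; `fromℤ-*` brings a sign on the right over to the left by
  -- commutativity.
  fromℤ-neg-* : ∀ i j → fromℤ (i ℤ.* j) ≈ fromℤ i * fromℤ j →
                fromℤ (ℤ.- i ℤ.* j) ≈ - fromℤ i * fromℤ j
  fromℤ-neg-* i j eq = begin
    fromℤ (ℤ.- i ℤ.* j)      ≡⟨ ≡.cong fromℤ (ℤₚ.neg-distribˡ-* i j) ⟨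
    fromℤ (ℤ.- (i ℤ.* j))    ≈⟨ fromℤ-neg (i ℤ.* j) ⟩
    - fromℤ (i ℤ.* j)        ≈⟨ -‿cong eq ⟩
    - (fromℤ i * fromℤ j)    ≈⟨ -‿distribˡ-* _ _ ⟩
    - fromℤ i * fromℤ j      ∎

  fromℤ-*-pos : ∀ i n → fromℤ (i ℤ.* + n) ≈ fromℤ i * n · 1#
  fromℤ-*-pos (+ m)    n = fromℤ-pos-* m n
  fromℤ-*-pos -[1+ m ] n = fromℤ-neg-* (+ suc m) (+ n) (fromℤ-pos-* (suc m) n)

  fromℤ-* : ∀ i j → fromℤ (i ℤ.* j) ≈ fromℤ i * fromℤ j
  fromℤ-* i (+ n)    = fromℤ-*-pos i n
  fromℤ-* i -[1+ n ] = begin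
    fromℤ (i ℤ.* -[1+ n ])          ≡⟨ ≡.cong fromℤ (ℤₚ.*-comm i -[1+ n ]) ⟩
    fromℤ (-[1+ n ] ℤ.* i)
      ≈⟨ fromℤ-neg-* (+ suc n) i (trans (reflexive (≡.cong fromℤ (ℤₚ.*-comm (+ suc n) i)))
           (trans (fromℤ-*-pos i (suc n)) (*-comm _ _))) ⟩
    - (suc n · 1#) * fromℤ i        ≈⟨ *-comm _ _ ⟩
    fromℤ i * - (suc n · 1#)        ∎

  fromℤ-homomorphism : ℤ.+-*-rawRing -Raw-AlmostCommutative⟶ fromCommutativeRing R
  fromℤ-homomorphism = record
    { ⟦_⟧    = fromℤ
    ; +-homo = fromℤ-+
    ; *-homo = fromℤ-*
    ; -‿homo = fromℤ-neg
    ; 0-homo = refl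
    -- With the optimised multiple, `1 · 1#` computes to `1#`.
    ; 1-homo = refl
    }

  -- Distinct integers may have equal images in `R`, so they yield no answer.
  fromℤ-≟ : WeaklyDecidable (λ i j → fromℤ i ≈ fromℤ j)
  fromℤ-≟ i j with i ℤₚ.≟ j
  ... | yes ≡.refl = just refl
  ... | no  _      = nothing

  open RingSolver ℤ.+-*-rawRing (fromCommutativeRing R) fromℤ-homomorphism fromℤ-≟ public

  -- Z evaluated in this ring is a solver expression denoting Z in R.
  syntaxRing : ℕ → RawRing _ _
  syntaxRing n = record
    { Carrier = Polynomial n
    ; _≈_ = _≡_
    ; _+_ = _:+_
    ; _*_ = _:*_
    ; -_  = :-_
    ; 0#  = con (+ 0)
    ; 1#  = con (+ 1)
    }

-- Test hypergraphs and their linear combinations.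

edge : ∀ {n} (m : Vec ℕ n) {_ : True (1 ℕₚ.<? Vec.sum m)} → Hyperedge n
edge m {1<d} = record { multiplicity = m ; d>1 = toWitness 1<d }

-- Links meet both vertices, loops only the first. Subscripts are degrees (2 if absent),
-- superscripts numbers of copies.
loops₂₄ loops₃₃ link₂loop₃ link₃loop₂ link·loop² link³ link²·loop : Hypergraph
loops₂₄    = hypergraph 1 (edge (2 ∷ []) ∷ edge (4 ∷ []) ∷ [])
loops₃₃    = hypergraph 1 (edge (3 ∷ []) ∷ edge (3 ∷ []) ∷ [])
link₂loop₃ = hypergraph 2 (edge (1 ∷ 1 ∷ []) ∷ edge (3 ∷ 0 ∷ []) ∷ [])
link₃loop₂ = hypergraph 2 (edge (2 ∷ 1 ∷ []) ∷ edge (2 ∷ 0 ∷ []) ∷ [])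
link·loop² = hypergraph 2 (edge (1 ∷ 1 ∷ []) ∷ edge (2 ∷ 0 ∷ []) ∷ edge (2 ∷ 0 ∷ []) ∷ [])
link³      = hypergraph 2 (edge (1 ∷ 1 ∷ []) ∷ edge (1 ∷ 1 ∷ []) ∷ edge (1 ∷ 1 ∷ []) ∷ [])
link²·loop = hypergraph 2 (edge (1 ∷ 1 ∷ []) ∷ edge (1 ∷ 1 ∷ []) ∷ edge (2 ∷ 0 ∷ []) ∷ [])

module Combinations {c ℓ} (R : RawRing c ℓ) where
  open RawRing R

  difference : Carrier → Carrier → Carrier
  difference a b = a + - b

  -- Let `z` be one plus the weight of a hyperedge of degree 2. Then `k` links and `3 - k` loops
  -- give `x(x-1)z^(3-k) + xz^3` for `k = 1, 2, 3`. The coefficients 1, 2, -3 for `k = 1, 3, 2`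
  -- cancel `xz^3` and leave `x(x-1)(z-1)(z-2)`. For `RC`, `z = y + 1`, so the root `z = 2` gives
  -- the factor `y - 1` shared with `Δ₁ RC`.
  relation : Carrier → Carrier → Carrier → Carrier
  relation a b c = (a + (b + b)) + - (c + (c + c))

  Δ₁ Δ₂ Δ₃ : PartitionFunction → Carrier → Carrier → Carrier
  Δ₁ F x y = difference (Z R F loops₂₄ x y) (Z R F loops₃₃ x y)
  Δ₂ F x y = difference (Z R F link₂loop₃ x y) (Z R F link₃loop₂ x y)
  Δ₃ F x y = relation (Z R F link·loop² x y) (Z R F link³ x y) (Z R F link²·loop x y)

-- Values of the combinations as polynomial identities.

module Evaluation {c ℓ} (R : CommutativeRing c ℓ) where
  open CommutativeRing R
  open IntegerCoefficients R
  open Combinations rawRing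
  private module S = Combinations (syntaxRing 2)

  -- Subsets and component counts evaluate in the syntax ring, which leaves a polynomial identity
  -- for the solver.
  Δ₁-RC : ∀ x y → Δ₁ RC x y ≈ x * y * (y - 1#) * (y - 1#)
  Δ₁-RC = solve 2 (λ x y → S.Δ₁ RC x y := x :* y :* (y :- con (+ 1)) :* (y :- con (+ 1))) refl

  -- On one vertex `Z` is `x` times the product of one plus each weight. For `P` this product is a
  -- power of `y` whose exponent is the total degree minus the number of hyperedges, equal for both
  -- hypergraphs.
  Δ₁-P : ∀ x y → Δ₁ P x y ≈ 0#
  Δ₁-P = solve 2 (λ x y → S.Δ₁ P x y := con (+ 0)) refl

  Δ₁-Grimmett : ∀ x y → Δ₁ Grimmett x y ≈ 0#
  Δ₁-Grimmett = solve 2 (λ x y → S.Δ₁ Grimmett x y := con (+ 0)) refl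

  -- A link of weight `u` and a loop of weight `v` give `(x^2 + xu)(1 + v)`, so exchanging the
  -- weights leaves the difference `x(x-1)(v-u)`.
  Δ₂-RC : ∀ x y → Δ₂ RC x y ≈ x * y * (x - 1#) * (y - 1#)
  Δ₂-RC = solve 2 (λ x y → S.Δ₂ RC x y := x :* y :* (x :- con (+ 1)) :* (y :- con (+ 1))) refl

  Δ₂-P : ∀ x y → Δ₂ P x y ≈ x * y * (x - 1#) * (y - 1#)
  Δ₂-P = solve 2 (λ x y → S.Δ₂ P x y := x :* y :* (x :- con (+ 1)) :* (y :- con (+ 1))) refl

  Δ₂-Grimmett : ∀ x y → Δ₂ Grimmett x y ≈ 0#
  Δ₂-Grimmett = solve 2 (λ x y → S.Δ₂ Grimmett x y := con (+ 0)) refl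

  Δ₃-RC : ∀ x y → Δ₃ RC x y ≈ x * y * (x - 1#) * (y - 1#)
  Δ₃-RC = solve 2 (λ x y → S.Δ₃ RC x y := x :* y :* (x :- con (+ 1)) :* (y :- con (+ 1))) refl

  Δ₃-P : ∀ x y → Δ₃ P x y ≈ x * (x - 1#) * (y - 1#) * (y - (1# + 1#))
  Δ₃-P = solve 2 (λ x y → S.Δ₃ P x y :=
    x :* (x :- con (+ 1)) :* (y :- con (+ 1)) :* (y :- (con (+ 1) :+ con (+ 1)))) refl

  Δ₃-Grimmett : ∀ x y → Δ₃ Grimmett x y ≈ x * (x - 1#) * (y - 1#) * (y - (1# + 1#))
  Δ₃-Grimmett = solve 2 (λ x y → S.Δ₃ Grimmett x y :=
    x :* (x :- con (+ 1)) :* (y :- con (+ 1)) :* (y :- (con (+ 1) :+ con (+ 1)))) refl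

  -- Single values such as this one show the scaling constant to be nonzero even where the
  -- combination itself vanishes.
  loops₂₄-P : ∀ x y → Z rawRing P loops₂₄ x y ≈ x * y * y * y * y
  loops₂₄-P = solve 2 (λ x y → Z (syntaxRing 2) P loops₂₄ x y := x :* y :* y :* y :* y) refl

  loops₂₄-Grimmett : ∀ x y → Z rawRing Grimmett loops₂₄ x y ≈ x * y * y
  loops₂₄-Grimmett = solve 2 (λ x y → Z (syntaxRing 2) Grimmett loops₂₄ x y := x :* y :* y) refl

  link₂loop₃-P : ∀ x y → Z rawRing P link₂loop₃ x y ≈ x * (x + y - 1#) * y * y
  link₂loop₃-P = solve 2 (λ x y → Z (syntaxRing 2) P link₂loop₃ x y :=
    x :* (x :+ y :- con (+ 1)) :* y :* y) refl

  link₂loop₃-Grimmett : ∀ x y → Z rawRing Grimmett link₂loop₃ x y ≈ x * (x + y - 1#) * y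
  link₂loop₃-Grimmett = solve 2 (λ x y → Z (syntaxRing 2) Grimmett link₂loop₃ x y :=
    x :* (x :+ y :- con (+ 1)) :* y) refl

  difference-scaled : ∀ {a b a′ b′} k → a ≈ k * a′ → b ≈ k * b′ →
                      difference a b ≈ k * difference a′ b′
  difference-scaled k a≈ b≈ = trans (+-cong a≈ (-‿cong b≈))
    (solve 3 (λ k a b → k :* a :- k :* b := k :* (a :- b)) refl k _ _)

  relation-scaled : ∀ {a b c a′ b′ c′} k → a ≈ k * a′ → b ≈ k * b′ → c ≈ k * c′ →
                    relation a b c ≈ k * relation a′ b′ c′
  relation-scaled k a≈ b≈ c≈ =
    trans (+-cong (+-cong a≈ (+-cong b≈ b≈)) (-‿cong (+-cong c≈ (+-cong c≈ c≈))))
      (solve 4 (λ k a b c → (k :* a :+ (k :* b :+ k :* b)) :- (k :* c :+ (k :* c :+ k :* c))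
                          := k :* ((a :+ (b :+ b)) :- (c :+ (c :+ c)))) refl k _ _ _)

-- Nonzero elements of a Heyting field.

module NonzeroProducts {c ℓ₁ ℓ₂} (K : HeytingField c ℓ₁ ℓ₂) where
  open HeytingField K
  open import Algebra.Apartness.Properties.HeytingCommutativeRing heytingCommutativeRing
    using (x#0y#0→xy#0)

  infix 4 _≉0
  _≉0 : Carrier → Set _
  x ≉0 = ¬ x ≈ 0#

  ≉0-resp-≈ : ∀ {x y} → x ≈ y → x ≉0 → y ≉0
  ≉0-resp-≈ x≈y x≉0 y≈0 = x≉0 (trans x≈y y≈0)

  infixl 7 _*≉0_
  -- Constructively `x ≉0` gives only the double negation of `x # 0#`. Since the goal is absurdity,
  -- both apartnesses may still be assumed.
  _*≉0_ : ∀ {x y} → x ≉0 → y ≉0 → x * y ≉0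
  _*≉0_ {x} {y} x≉0 y≉0 xy≈0 =
    x≉0 (proj₁ (tight x 0#) λ x#0 →
    y≉0 (proj₁ (tight y 0#) λ y#0 →
    proj₂ (tight (x * y) 0#) xy≈0 (x#0y#0→xy#0 x#0 y#0)))

  left-factor≉0 : ∀ {x y} → x * y ≉0 → x ≉0
  left-factor≉0 {y = y} xy≉0 x≈0 = xy≉0 (trans (*-congʳ x≈0) (zeroˡ y))

  right-factor≉0 : ∀ {x y} → x * y ≉0 → y ≉0
  right-factor≉0 {x} xy≉0 y≈0 = xy≉0 (trans (*-congˡ y≈0) (zeroʳ x))

  four-factors≉0 : ∀ {x y z u} → x * y * z * u ≉0 → x ≉0 × y ≉0 × z ≉0 × u ≉0
  four-factors≉0 p =
      left-factor≉0 (left-factor≉0 (left-factor≉0 p))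
    , right-factor≉0 (left-factor≉0 (left-factor≉0 p))
    , right-factor≉0 (left-factor≉0 p)
    , right-factor≉0 p

-- Excluding the six specializations at a generic point.

module NoSpecialization {c ℓ₁ ℓ₂} (K : HeytingField c ℓ₁ ℓ₂) where
  open HeytingField K
  open NonzeroProducts K
  open Combinations (Field.rawRing K)
  open Evaluation (HeytingCommutativeRing.commutativeRing heytingCommutativeRing)

  ZK : PartitionFunction → Hypergraph → Carrier → Carrier → Carrier
  ZK = Z (Field.rawRing K)

  -- Collects the factors of the values at `(q , w)` that have to be nonzero.
  record Generic (q w : Carrier) : Set ℓ₁ where
    field
      q≉0     : q ≉0
      w≉0     : w ≉0
      q-1≉0   : q - 1# ≉0
      w-1≉0   : w - 1# ≉0
      w-2≉0   : w - (1# + 1#) ≉0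
      q+w-1≉0 : q + w - 1# ≉0

  module _ {q w : Carrier} (generic : Generic q w)
           (s t : Carrier) (f : ℕ → ℕ → ℕ → ℕ → Carrier) where
    open Generic generic

    record Specializes (F₁ F₂ : PartitionFunction) : Set ℓ₁ where
      constructor specialization
      field
        at : ∀ H → ZK F₂ H q w ≈
          f (order H) (κ H) (length (hyperedges H)) (totalDegree (hyperedges H)) * ZK F₁ H s t

    open Specializes

    -- f at the parameters common to the hypergraphs of Δ₁, Δ₂ and Δ₃ respectively.
    k₁ k₂ k₃ : Carrier
    k₁ = f 1 1 2 6
    k₂ = f 2 1 2 5
    k₃ = f 2 1 3 6

    module _ {F₁ F₂} (z : Specializes F₁ F₂) where

      Δ₁-scaled : Δ₁ F₂ q w ≈ k₁ * Δ₁ F₁ s t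
      -- The parameters of both hypergraphs, including `κ`, evaluate to the arguments of `f` in
      -- `k₁`.
      Δ₁-scaled = difference-scaled k₁ (at z loops₂₄) (at z loops₃₃)

      Δ₂-scaled : Δ₂ F₂ q w ≈ k₂ * Δ₂ F₁ s t
      Δ₂-scaled = difference-scaled k₂ (at z link₂loop₃) (at z link₃loop₂)

      Δ₃-scaled : Δ₃ F₂ q w ≈ k₃ * Δ₃ F₁ s t
      Δ₃-scaled = relation-scaled k₃
        (at z link·loop²) (at z link³) (at z link²·loop)

    ZK-loops₂₄-P≉0 : ZK P loops₂₄ q w ≉0
    ZK-loops₂₄-P≉0 = ≉0-resp-≈ (sym (loops₂₄-P q w))
      (q≉0 *≉0 w≉0 *≉0 w≉0 *≉0 w≉0 *≉0 w≉0)

    ZK-loops₂₄-Grimmett≉0 : ZK Grimmett loops₂₄ q w ≉0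
    ZK-loops₂₄-Grimmett≉0 = ≉0-resp-≈ (sym (loops₂₄-Grimmett q w)) (q≉0 *≉0 w≉0 *≉0 w≉0)

    ZK-link₂loop₃-Grimmett≉0 : ZK Grimmett link₂loop₃ q w ≉0
    ZK-link₂loop₃-Grimmett≉0 = ≉0-resp-≈ (sym (link₂loop₃-Grimmett q w))
      (q≉0 *≉0 q+w-1≉0 *≉0 w≉0)

    Δ₁-RC≉0 : Δ₁ RC q w ≉0
    Δ₁-RC≉0 = ≉0-resp-≈ (sym (Δ₁-RC q w)) (q≉0 *≉0 w≉0 *≉0 w-1≉0 *≉0 w-1≉0)

    Δ₂-P≉0 : Δ₂ P q w ≉0
    Δ₂-P≉0 = ≉0-resp-≈ (sym (Δ₂-P q w)) (q≉0 *≉0 w≉0 *≉0 q-1≉0 *≉0 w-1≉0)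

    Δ₃-Grimmett≉0 : Δ₃ Grimmett q w ≉0
    Δ₃-Grimmett≉0 = ≉0-resp-≈ (sym (Δ₃-Grimmett q w))
      (q≉0 *≉0 q-1≉0 *≉0 w-1≉0 *≉0 w-2≉0)

    scaled≉0 : ∀ {x y k} → x ≈ k * y → x ≉0 → k ≉0 × y ≉0
    scaled≉0 x≈ky x≉0 = left-factor≉0 ky≉0 , right-factor≉0 ky≉0
      where ky≉0 = ≉0-resp-≈ x≈ky x≉0

    P-to-RC : ¬ Specializes P RC
    P-to-RC z = proj₂ (scaled≉0 (Δ₁-scaled z) Δ₁-RC≉0) (Δ₁-P s t)

    Grimmett-to-RC : ¬ Specializes Grimmett RC
    Grimmett-to-RC z = proj₂ (scaled≉0 (Δ₁-scaled z) Δ₁-RC≉0) (Δ₁-Grimmett s t)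

    Grimmett-to-P : ¬ Specializes Grimmett P
    Grimmett-to-P z = proj₂ (scaled≉0 (Δ₂-scaled z) Δ₂-P≉0) (Δ₂-Grimmett s t)

    -- Every factor of Δ₁ RC is a factor of the common value of Δ₂ RC and Δ₃ RC.
    not-from-RC : ∀ {F} → Specializes RC F → Δ₁ F q w ≈ 0# → ZK F loops₂₄ q w ≉0 →
                  ¬ (s * t * (s - 1#) * (t - 1#) ≉0)
    not-from-RC z Δ₁≈0 loops≉0 p =
      let s≉0 , t≉0 , _ , t-1≉0 = four-factors≉0 p
          k₁≉0 , _ = scaled≉0 (at z loops₂₄) loops≉0
      in (k₁≉0 *≉0 ≉0-resp-≈ (sym (Δ₁-RC s t)) (s≉0 *≉0 t≉0 *≉0 t-1≉0 *≉0 t-1≉0))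
           (trans (sym (Δ₁-scaled z)) Δ₁≈0)

    RC-to-P : ¬ Specializes RC P
    RC-to-P z = not-from-RC z (Δ₁-P q w) ZK-loops₂₄-P≉0
      (≉0-resp-≈ (Δ₂-RC s t) (proj₂ (scaled≉0 (Δ₂-scaled z) Δ₂-P≉0)))

    RC-to-Grimmett : ¬ Specializes RC Grimmett
    RC-to-Grimmett z = not-from-RC z (Δ₁-Grimmett q w) ZK-loops₂₄-Grimmett≉0
      -- `Δ₃` takes the place of `Δ₂`, because `Δ₂ Grimmett` is identically zero.
      (≉0-resp-≈ (Δ₃-RC s t) (proj₂ (scaled≉0 (Δ₃-scaled z) Δ₃-Grimmett≉0)))

    P-to-Grimmett : ¬ Specializes P Grimmett
    P-to-Grimmett z =
      let s≉0 , s-1≉0 , t-1≉0 , _ = four-factors≉0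
            (≉0-resp-≈ (Δ₃-P s t) (proj₂ (scaled≉0 (Δ₃-scaled z) Δ₃-Grimmett≉0)))
          -- `Δ₃ P` lacks the factor `t`. The single value at `link₂loop₃` supplies it and also
          -- makes `k₂` nonzero, which `Δ₂ Grimmett`, being zero, cannot show.
          k₂≉0 , link≉0 = scaled≉0 (at z link₂loop₃) ZK-link₂loop₃-Grimmett≉0
          t≉0 = right-factor≉0 (≉0-resp-≈ (link₂loop₃-P s t) link≉0)
      in (k₂≉0 *≉0 ≉0-resp-≈ (sym (Δ₂-P s t)) (s≉0 *≉0 t≉0 *≉0 s-1≉0 *≉0 t-1≉0))
           (trans (sym (Δ₂-scaled z)) (Δ₂-Grimmett q w))

    no-specialization : ∀ F₁ F₂ → F₁ ≢ F₂ → ¬ Specializes F₁ F₂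
    no-specialization RC       RC       ≢ = contradiction ≡.refl ≢
    no-specialization RC       P        _ = RC-to-P
    no-specialization RC       Grimmett _ = RC-to-Grimmett
    no-specialization P        RC       _ = P-to-RC
    no-specialization P        P        ≢ = contradiction ≡.refl ≢
    no-specialization P        Grimmett _ = P-to-Grimmett
    no-specialization Grimmett RC       _ = Grimmett-to-RC
    no-specialization Grimmett P        _ = Grimmett-to-P
    no-specialization Grimmett Grimmett ≢ = contradiction ≡.refl ≢

-- Genericity of the indeterminates in every extension field.

-- i is the exponent of q and j that of w.
HasUnitCoefficient : RawRing.Carrier ℂ[q,w] → ℕ → ℕ → Set
HasUnitCoefficient p i j = ∀ n → seq (proj₁ (coeff ℂ (coeff (Poly ℂ) p j) i)) n ≡ 1ℚ

-- A real equal to zero is eventually within one half of zero, but the constant sequence 1 never is.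
unit-coefficient⇒≉0 : ∀ p i j → HasUnitCoefficient p i j →
                      ¬ RawRing._≈_ ℂ[q,w] p (RawRing.0# ℂ[q,w])
unit-coefficient⇒≉0 p i j c≡1 p≈0 =
  let N , close = proj₁ (p≈0 j i) ½ (ℚₚ.positive⁻¹ ½)
  in contradiction
       (≡.subst (λ r → ℚ.∣ r ℚ.- 0ℚ ∣ ℚ.≤ ½) (c≡1 N) (close N ℕₚ.≤-refl))
       (from-no (1ℚ ℚₚ.≤? ½))

module _ {a b d c ℓ₁ ℓ₂} (ℂ⟨q,w⟩ : RationalFunctionField a b d)
         (E : Extension (RationalFunctionField.𝔽 ℂ⟨q,w⟩) c ℓ₁ ℓ₂) where
  private
    module L = RationalFunctionField ℂ⟨q,w⟩
    open module ℂq,w = RawRing ℂ[q,w] using () renaming (_+_ to _⊞_; -_ to ⊟_; 1# to 1ᵖ)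
  open Extension E
  open NonzeroProducts 𝕂

  embed : ℂq,w.Carrier → Carrier
  embed p = ι (L.polynomial p)

  open IsRingMonomorphism (isRingMonomorphism trans L.monomorphism monomorphism)
    using (+-homo; -‿homo; 0#-homo; 1#-homo; injective)

  embed-≉0 : ∀ p i j → HasUnitCoefficient p i j → embed p ≉0
  embed-≉0 p i j c≡1 ep≈0 =
    unit-coefficient⇒≉0 p i j c≡1 (injective (trans ep≈0 (sym 0#-homo)))

  -- Pulls a difference in the extension field back to a polynomial, where one unit coefficient
  -- decides.
  embed-minus-≉0 : ∀ p r {x y} → embed p ≈ x → embed r ≈ y →
                   ∀ i j → HasUnitCoefficient (p ⊞ ⊟ r) i j → x - y ≉0
  embed-minus-≉0 p r p≈x r≈y i j c≡1 = ≉0-resp-≈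
    (trans (+-homo p (⊟ r)) (+-cong p≈x (trans (-‿homo r) (-‿cong r≈y))))
    (embed-≉0 (p ⊞ ⊟ r) i j c≡1)

  -- The chosen monomial occurs in just one term of each polynomial, so its coefficient computes to
  -- the constant sequence 1.
  indeterminates-generic : NoSpecialization.Generic 𝕂 (ι L.q) (ι L.w)
  indeterminates-generic = record
    { q≉0     = embed-≉0 qᵖ 1 0 λ _ → ≡.refl
    ; w≉0     = embed-≉0 wᵖ 0 1 λ _ → ≡.refl
    ; q-1≉0   = embed-minus-≉0 qᵖ 1ᵖ refl 1#-homo 1 0 λ _ → ≡.refl
    ; w-1≉0   = embed-minus-≉0 wᵖ 1ᵖ refl 1#-homo 0 1 λ _ → ≡.refl
    ; w-2≉0   = embed-minus-≉0 wᵖ (1ᵖ ⊞ 1ᵖ) refl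
                  (trans (+-homo 1ᵖ 1ᵖ) (+-cong 1#-homo 1#-homo)) 0 1 λ _ → ≡.refl
    ; q+w-1≉0 = embed-minus-≉0 (qᵖ ⊞ wᵖ) 1ᵖ (+-homo qᵖ wᵖ) 1#-homo 1 0 λ _ → ≡.refl
    }

corollary5p9 :
  ∀ {a b d c ℓ₁ ℓ₂} (ℂ⟨q,w⟩ : RationalFunctionField a b d) (F₁ F₂ : PartitionFunction) → F₁ ≢ F₂ →
    let module L = RationalFunctionField ℂ⟨q,w⟩ in
    ¬ (Σ[ K ∈ Extension L.𝔽 c ℓ₁ ℓ₂ ]
       let module K = Extension K
           ZK = Z (Field.rawRing K.𝕂) in
       Σ[ s ∈ K.Carrier ] Σ[ t ∈ K.Carrier ] Σ[ f ∈ (ℕ → ℕ → ℕ → ℕ → K.Carrier) ]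
       (∀ (H : Hypergraph) →
          ZK F₂ H (K.ι L.q) (K.ι L.w) K.≈
            (f (order H) (κ H) (length (hyperedges H)) (totalDegree (hyperedges H))
              K.* ZK F₁ H s t)))
corollary5p9 ℂ⟨q,w⟩ F₁ F₂ F₁≢F₂ (K , s , t , f , specializes) =
  NoSpecialization.no-specialization (Extension.𝕂 K) (indeterminates-generic ℂ⟨q,w⟩ K)
    s t f F₁ F₂ F₁≢F₂ (NoSpecialization.specialization specializes)
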